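{- Let $U$ be an infinite set with $|U| = \kappa$, $\aleph_0 \leq \kappa$. Then for every $S \subseteq U$ such that $|S| < |U|$ there exists an injective function $\star_S : U^2 \to U$ such that for every binary tree $t \in \mathsf{BT}$ with $t \neq \mathtt{nil}$, $\left|\mathit{fix}_t(\star_S)\right| = |S|$.
   Context: Binary trees: $\mathsf{BT}$ is the smallest set of terms generated by the grammar $\mathsf{bt} ::= \mathtt{nil} \mid \mathtt{bin}\ \mathsf{bt}\ \mathsf{bt}$. For a set $U$, a function $f : U^2 \to U$ and $u \in U$, define $\mathit{map}\ t\ f\ u \in U$ for $t\in\mathsf{BT}$ recursively by $\mathit{map}\ \mathtt{nil}\ f\ u = u$ and $\mathit{map}\ (\mathtt{bin}\ t_1\ t_2)\ f\ u = f(\mathit{map}\ t_1\ f\ u,\ \mathit{map}\ t_2\ f\ u)$. For $\star : U^2 \to U$ and $t \in \mathsf{BT}$, the $t$-controlled fixpoints of $\star$ are $\mathit{fix}_t(\star) = \{u \in U \mid \mathit{map}\ t\ \star\ u = u\}$. -}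

module Defs where

open import Data.Product using (_×_; _,_; proj₁)
open import Function.Bundles using (Injection; Bijection)
open import Level using (Level; _⊔_)
open import Relation.Binary.Bundles using (Setoid)
open import Relation.Binary.PropositionalEquality using (_≡_; setoid)
import Relation.Binary.Construct.On as On
open import Relation.Nullary using (¬_)
open import Relation.Unary using (Pred)

private
  variable
    a b ℓ₁ ℓ₂ p : Level

data BT : Set where
  nil : BT
  bin : BT → BT → BT

map : {U : Set a} → BT → (U × U → U) → U → U
map nil         f u = u
map (bin t₁ t₂) f u = f (map t₁ f u , map t₂ f u)

fix : {U : Set a} → BT → (U × U → U) → Pred U a
fix t ⋆ u = map t ⋆ u ≡ u

-- The elements of a subset are compared in the ambient set, so that distinct
-- proofs of membership do not count as distinct elements.
⟦_⟧ : {U : Set a} → Pred U p → Setoid (a ⊔ p) a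
⟦_⟧ {U = U} P = On.setoid (setoid U) (proj₁ {B = P})

infix 4 _≈ᶜ_ _≤ᶜ_ _<ᶜ_

_≈ᶜ_ : Setoid a ℓ₁ → Setoid b ℓ₂ → Set (a ⊔ b ⊔ ℓ₁ ⊔ ℓ₂)
A ≈ᶜ B = Bijection A B

_≤ᶜ_ : Setoid a ℓ₁ → Setoid b ℓ₂ → Set (a ⊔ b ⊔ ℓ₁ ⊔ ℓ₂)
A ≤ᶜ B = Injection A B

_<ᶜ_ : Setoid a ℓ₁ → Setoid b ℓ₂ → Set (a ⊔ b ⊔ ℓ₁ ⊔ ℓ₂)
A <ᶜ B = A ≤ᶜ B × ¬ (A ≈ᶜ B)

{-# OPTIONS --safe #-}
module Submission where

-- An injection p : U × U → U (|U|² = |U|, by Zorn's lemma) first yields an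
-- injection of U into the complement of S, and hence one, code : U × ℕ → U, that
-- avoids S. Call n + 1 the rank of code (w , n), and 0 the rank of all other
-- points. Put s ⋆ s = s for s ∈ S, and x ⋆ y = code (p (x , y) , max of the ranks)
-- otherwise: then x ⋆ y has larger rank than both x and y. Hence every s ∈ S is fixed by
-- every tree, while for u ∉ S each t ≠ nil strictly raises the rank of u.
--
-- Dec is not truncated, so excluded middle also provides choice.

open import Axiom.ExcludedMiddle using (ExcludedMiddle)
open import Axiom.Extensionality.Propositional using (Extensionality; lower-extensionality)
open import Data.Bool using (Bool; true; false; T; not)
open import Data.Bool.Properties using (T-irrelevant)
open import Data.Empty using (⊥-elim)
open import Data.Nat using (ℕ; suc; _+_; _*_; _≤_; _<_; _⊔_; s≤s)
open import Data.Nat.Properties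
open import Data.Product using (_×_; Σ-syntax; _,_; proj₁; proj₂; ∃)
open import Data.Product.Properties using (,-injectiveˡ; ,-injectiveʳ)
open import Data.Product.Function.NonDependent.Propositional using (_×-↣_)
import Data.Sum as Sum
open import Data.Sum.Function.Propositional using (_⊎-↣_)
open import Data.Sum using (_⊎_; inj₁; inj₂; [_,_]′)
open import Data.Sum.Properties using (inj₁-injective; inj₂-injective)
open import Function using (_∘_; id)
open import Function.Bundles using (Injection; _↣_; mk↣)
open import Function.Construct.Composition using (_↣-∘_)
open import Function.Construct.Identity using (↣-id)
open import Function.Definitions using (Injective)
open import Function.Properties.Bijection using (Bijection⇒Inverse)
import Function.Properties.Inverse as Inverse
open import Function.Properties.Inverse using (Inverse⇒Bijection)
open import Level using (Level; Lift; lift; lower)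
open import Relation.Binary.Definitions using (tri<; tri≈; tri>)
open import Relation.Binary.PropositionalEquality
  using (_≡_; _≢_; setoid; refl; sym; trans; cong; cong₂; subst)
open import Relation.Nullary using (¬_; yes; no; contradiction)
open import Relation.Nullary.Decidable using (⌊_⌋; toWitness; fromWitness; decidable-stable)
open import Relation.Unary using (Pred)
open import Defs

open Injection using (to; injective)

private
  variable
    a : Level
    X : Set a

-- Boolean-valued subsets

T-antisym : ∀ {b c} → (T b → T c) → (T c → T b) → b ≡ c
T-antisym {false} {false} _   _   = refl
T-antisym {false} {true}  _   c⇒b = ⊥-elim (c⇒b _)
T-antisym {true}  {false} b⇒c _   = ⊥-elim (b⇒c _)
T-antisym {true}  {true}  _   _   = refl

-- Boolean-valued, so that the subsets of a type stay in the universe of the type.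
Subset : Set a → Set a
Subset X = X → Bool

infix 4 _∈_ _⊆_

_∈_ : X → Subset X → Set
x ∈ A = T (A x)

_⊆_ : {X : Set a} → Subset X → Subset X → Set a
A ⊆ B = ∀ x → x ∈ A → x ∈ B

∁ : Subset X → Subset X
∁ A = not ∘ A

Elem : {X : Set a} → Subset X → Set a
Elem A = ∃ (_∈ A)

Elem-≡ : {A : Subset X} {x y : Elem A} → proj₁ x ≡ proj₁ y → x ≡ y
Elem-≡ {x = x , p} {y = .x , q} refl = cong (x ,_) (T-irrelevant p q)

∈⊎∈∁ : (A : Subset X) → ∀ x → x ∈ A ⊎ x ∈ ∁ A
∈⊎∈∁ A x with A x
... | true  = inj₁ _
... | false = inj₂ _

∈∁⇒∉ : (A : Subset X) → ∀ {x} → x ∈ ∁ A → ¬ x ∈ A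
∈∁⇒∉ A {x} p q with A x
∈∁⇒∉ A {x} () q | true
∈∁⇒∉ A {x} p () | false

Chain : {X : Set a} → Subset (Subset X) → Set a
Chain C = ∀ {A B} → A ∈ C → B ∈ C → A ⊆ B ⊎ B ⊆ A

-- A pairing function on the natural numbers

square+n : ℕ × ℕ → ℕ
square+n (m , n) = (m + n) * (m + n) + m

-- Pairs with sum `s` take values from `s * s` to `s * s + s`, which is below `suc s * suc s`, so
-- different sums occupy disjoint blocks.
square+n-< : ∀ m n m′ n′ → m + n < m′ + n′ → square+n (m , n) < square+n (m′ , n′)
square+n-< m n m′ n′ s<s′ = begin-strict
  s * s + m                  ≤⟨ +-monoʳ-≤ (s * s) (m≤m+n m n) ⟩
  s * s + s                  ≡⟨ +-comm (s * s) s ⟩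
  suc s * s                  <⟨ *-monoʳ-< (suc s) (n<1+n s) ⟩
  suc s * suc s              ≤⟨ *-mono-≤ s<s′ s<s′ ⟩
  (m′ + n′) * (m′ + n′)      ≤⟨ m≤m+n _ m′ ⟩
  square+n (m′ , n′)         ∎
  where
  open ≤-Reasoning
  s = m + n

square+n-injective : Injective _≡_ _≡_ square+n
square+n-injective {m , n} {m′ , n′} eq with <-cmp (m + n) (m′ + n′)
... | tri< s<s′ _ _ = contradiction eq (<⇒≢ (square+n-< m n m′ n′ s<s′))
... | tri> _ _ s′<s = contradiction (sym eq) (<⇒≢ (square+n-< m′ n′ m n s′<s))
... | tri≈ _ s≡s′ _ = cong₂ _,_ m≡m′ (+-cancelˡ-≡ m n n′ (trans s≡s′ (cong (_+ n′) (sym m≡m′))))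
  where
  m≡m′ : m ≡ m′
  m≡m′ = +-cancelˡ-≡ ((m + n) * (m + n)) m m′
    (trans eq (cong (λ s → s * s + m′) (sym s≡s′)))

-- Injections between sums, squares and subsets

-- The two copies of `A` become the disjoint columns over `x` and over `y` in the square.
⊎-square : {A : Set a} → (A × A) ↣ A → ∀ {x y : A} → x ≢ y → (A ⊎ A) ↣ A
⊎-square {A = A} p {x} {y} x≢y = mk↣ {to = f} f-injective
  where
  f : A ⊎ A → A
  f (inj₁ z) = to p (x , z)
  f (inj₂ z) = to p (y , z)

  f-injective : Injective _≡_ _≡_ f
  f-injective {inj₁ _} {inj₁ _} eq = cong inj₁ (,-injectiveʳ (injective p eq))
  f-injective {inj₁ _} {inj₂ _} eq = contradiction (,-injectiveˡ (injective p eq)) x≢y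
  f-injective {inj₂ _} {inj₁ _} eq = contradiction (sym (,-injectiveˡ (injective p eq))) x≢y
  f-injective {inj₂ _} {inj₂ _} eq = cong inj₂ (,-injectiveʳ (injective p eq))

-- The three new quarters of (A ⊎ A) × (A ⊎ A) go into the second copy of A.
module Doubling {A : Set a} (p : (A × A) ↣ A) (e : (A ⊎ A) ↣ A) where

  outer : ((A ⊎ A) × (A ⊎ A)) ↣ A
  outer = p ↣-∘ (e ×-↣ e)

  doubling-to : (A ⊎ A) × (A ⊎ A) → A ⊎ A
  doubling-to (inj₁ x , inj₁ y)     = inj₁ (to p (x , y))
  doubling-to v@(inj₁ _ , inj₂ _)   = inj₂ (to outer v)
  doubling-to v@(inj₂ _ , _)        = inj₂ (to outer v)

  doubling-injective : Injective _≡_ _≡_ doubling-to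
  doubling-injective {inj₁ _ , inj₁ _} {inj₁ _ , inj₁ _} eq
    with refl ← injective p (inj₁-injective eq) = refl
  doubling-injective {inj₁ _ , inj₁ _} {inj₁ _ , inj₂ _} ()
  doubling-injective {inj₁ _ , inj₁ _} {inj₂ _ , _}      ()
  doubling-injective {inj₁ _ , inj₂ _} {inj₁ _ , inj₁ _} ()
  doubling-injective {inj₂ _ , _}      {inj₁ _ , inj₁ _} ()
  doubling-injective {inj₁ _ , inj₂ _} {inj₁ _ , inj₂ _} eq = injective outer (inj₂-injective eq)
  doubling-injective {inj₁ _ , inj₂ _} {inj₂ _ , _}      eq = injective outer (inj₂-injective eq)
  doubling-injective {inj₂ _ , _}      {inj₁ _ , inj₂ _} eq = injective outer (inj₂-injective eq)
  doubling-injective {inj₂ _ , _}      {inj₂ _ , _}      eq = injective outer (inj₂-injective eq)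

  doubling : ((A ⊎ A) × (A ⊎ A)) ↣ (A ⊎ A)
  doubling = mk↣ doubling-injective

module Partition (A : Subset X) where

  split : X ↣ (Elem A ⊎ Elem (∁ A))
  split = mk↣ λ {x} {y} eq → go (∈⊎∈∁ A x) (∈⊎∈∁ A y) eq
    where
    tag : ∀ {x} → x ∈ A ⊎ x ∈ ∁ A → Elem A ⊎ Elem (∁ A)
    tag = Sum.map (_ ,_) (_ ,_)

    go : ∀ {x y} (p : x ∈ A ⊎ x ∈ ∁ A) (q : y ∈ A ⊎ y ∈ ∁ A) → tag p ≡ tag q → x ≡ y
    go (inj₁ _) (inj₁ _) eq = cong proj₁ (inj₁-injective eq)
    go (inj₁ _) (inj₂ _) ()
    go (inj₂ _) (inj₁ _) ()
    go (inj₂ _) (inj₂ _) eq = cong proj₁ (inj₂-injective eq)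

  elem : Elem A ↣ X
  elem = mk↣ Elem-≡

  -- The first copy is sent by inclusion, so a pairing transported along this map can extend one
  -- that lives on `A`.
  join : Elem A ↣ Elem (∁ A) → (Elem A ⊎ Elem A) ↣ X
  join g = mk↣ {to = f} f-injective
    where
    f : Elem A ⊎ Elem A → X
    f (inj₁ x) = proj₁ x
    f (inj₂ x) = proj₁ (to g x)

    disjoint : (x : Elem A) (y : Elem (∁ A)) → proj₁ x ≢ proj₁ y
    disjoint (_ , x∈A) (_ , x∈∁A) refl = ∈∁⇒∉ A x∈∁A x∈A

    f-injective : Injective _≡_ _≡_ f
    f-injective {inj₁ x} {inj₁ y} eq = cong inj₁ (Elem-≡ eq)
    f-injective {inj₁ x} {inj₂ y} eq = contradiction eq (disjoint x (to g y))
    f-injective {inj₂ x} {inj₁ y} eq = contradiction (sym eq) (disjoint y (to g x))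
    f-injective {inj₂ x} {inj₂ y} eq = cong inj₂ (injective g (Elem-≡ eq))

-- Comprehension, unions and Zorn's lemma

module Classical {ℓ} (em : ExcludedMiddle ℓ) (ext : Extensionality ℓ ℓ) where

  ⊆-antisym : {X : Set ℓ} {A B : Subset X} → A ⊆ B → B ⊆ A → A ≡ B
  ⊆-antisym A⊆B B⊆A =
    lower-extensionality ℓ ℓ ext λ x → T-antisym (A⊆B x) (B⊆A x)

  abstract
    ⟨_⟩ : {X : Set ℓ} → (X → Set ℓ) → Subset X
    ⟨ P ⟩ x = ⌊ em {P x} ⌋

    ∈⟨⟩⁺ : {X : Set ℓ} {P : X → Set ℓ} → ∀ {x} → P x → x ∈ ⟨ P ⟩
    ∈⟨⟩⁺ = fromWitness

    ∈⟨⟩⁻ : {X : Set ℓ} {P : X → Set ℓ} → ∀ {x} → x ∈ ⟨ P ⟩ → P x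
    ∈⟨⟩⁻ = toWitness

  ⋃ : {X : Set ℓ} → Subset (Subset X) → Subset X
  ⋃ C = ⟨ (λ x → ∃ λ A → A ∈ C × x ∈ A) ⟩

  ⊆⋃ : {X : Set ℓ} {C : Subset (Subset X)} {A : Subset X} → A ∈ C → A ⊆ ⋃ C
  ⊆⋃ A∈C x x∈A = ∈⟨⟩⁺ (_ , A∈C , x∈A)

  ∈⋃⁻ : {X : Set ℓ} (C : Subset (Subset X)) → ∀ {x} → x ∈ ⋃ C → ∃ λ A → A ∈ C × x ∈ A
  ∈⋃⁻ C = ∈⟨⟩⁻

  -- Zorn's lemma for inclusion. The tower generated by base under a proper
  -- extension operation and unions is a chain, because every member Y is
  -- extreme: A ⊊ Y implies grow A ⊆ Y. Its union cannot be extended.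
  module Zorn {X : Set ℓ} (P : Subset X → Set ℓ) (base : Subset X) (P-base : P base)
    (P-⋃ : ∀ {C} → base ∈ C → (∀ {A} → A ∈ C → P A) → Chain C → P (⋃ C)) where

    Extension : Subset X → Set ℓ
    Extension A = ∃ λ B → P B × A ⊆ B × ¬ B ⊆ A

    -- A positive answer of `em` contains an extension, so this is a choice function; sets without
    -- one are left alone.
    grow : Subset X → Subset X
    grow A with em {Extension A}
    ... | yes (B , _) = B
    ... | no _        = A

    ⊆grow : ∀ A → A ⊆ grow A
    ⊆grow A with em {Extension A}
    ... | yes (_ , _ , A⊆B , _) = A⊆B
    ... | no _                  = λ _ → id

    P-grow : ∀ {A} → P A → P (grow A)
    P-grow {A} PA with em {Extension A}
    ... | yes (_ , PB , _) = PB
    ... | no _             = PA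

    grow⊆⇒maximal : ∀ {A} → grow A ⊆ A → ∀ {B} → P B → A ⊆ B → B ⊆ A
    grow⊆⇒maximal {A} grow⊆A {B} PB A⊆B with em {Extension A}
    ... | yes (_ , _ , _ , B⊈A) = contradiction grow⊆A B⊈A
    ... | no ¬extension = decidable-stable em λ B⊈A → ¬extension (B , PB , A⊆B , B⊈A)

    -- Demanding `base ∈ C` excludes the empty union, so every member contains `base`.
    data Tower : Subset X → Set ℓ where
      bottom : Tower base
      step   : ∀ {A} → Tower A → Tower (grow A)
      union  : ∀ C → base ∈ C → (∀ A → A ∈ C → Tower A) → Tower (⋃ C)

    base⊆ : ∀ {A} → Tower A → base ⊆ A
    base⊆ bottom            _ = id
    base⊆ (step {A} t)      x = ⊆grow A x ∘ base⊆ t x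
    base⊆ (union C base∈ _) x = ⊆⋃ {C = C} base∈ x

    Extreme : Subset X → Set ℓ
    Extreme Y = ∀ {A} → Tower A → A ⊆ Y → ¬ Y ⊆ A → grow A ⊆ Y

    -- Induction on `A`. At a step with `A ⊆ Y`, either the inclusion is proper and extremeness
    -- applies, or `A` equals `Y`. A union lies in `Y` unless one of its members contains `grow Y`.
    extreme-compare : ∀ {Y} → Tower Y → Extreme Y → ∀ {A} → Tower A → A ⊆ Y ⊎ grow Y ⊆ A
    extreme-compare y e bottom = inj₁ (base⊆ y)
    extreme-compare {Y} y e (step {A} t) with extreme-compare y e t
    ... | inj₂ growY⊆A = inj₂ λ x → ⊆grow A x ∘ growY⊆A x
    ... | inj₁ A⊆Y with em {Y ⊆ A}
    ...   | no Y⊈A = inj₁ (e t A⊆Y Y⊈A)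
    ...   | yes Y⊆A = inj₂ (subst (λ Z → grow Y ⊆ grow Z) (⊆-antisym Y⊆A A⊆Y) (λ _ → id))
    extreme-compare {Y} y e (union C _ t) with em {∃ λ A → A ∈ C × grow Y ⊆ A}
    ... | yes (A , A∈C , growY⊆A) = inj₂ λ x → ⊆⋃ {C = C} A∈C x ∘ growY⊆A x
    ... | no none = inj₁ λ x x∈⋃ →
      let A , A∈C , x∈A = ∈⋃⁻ C x∈⋃ in
      [ (λ A⊆Y → A⊆Y x x∈A) , (λ growY⊆A → contradiction (A , A∈C , growY⊆A) none) ]′
        (extreme-compare y e (t A A∈C))

    -- Induction on `Y`. Below `grow Y`, comparison with `Y` leaves `A ⊆ Y`, proper or equal. Below
    -- a union, some member `Z` is not inside `A`, so `A` is properly inside `Z`.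
    extreme : ∀ {Y} → Tower Y → Extreme Y
    extreme bottom t _ base⊈A = contradiction (base⊆ t) base⊈A
    extreme (step {Y} y) {A} t A⊆growY growY⊈A with extreme-compare y (extreme y) t
    ... | inj₂ growY⊆A = contradiction growY⊆A growY⊈A
    ... | inj₁ A⊆Y with em {Y ⊆ A}
    ...   | no Y⊈A = λ x → ⊆grow Y x ∘ extreme y t A⊆Y Y⊈A x
    ...   | yes Y⊆A = subst (λ Z → grow Z ⊆ grow Y) (⊆-antisym Y⊆A A⊆Y) (λ _ → id)
    extreme (union C _ y) {A} t A⊆⋃ ⋃⊈A with em {∃ λ Z → Z ∈ C × ¬ Z ⊆ A}
    ... | no none = contradiction
      (λ x x∈⋃ → let Z , Z∈C , x∈Z = ∈⋃⁻ C x∈⋃ in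
        decidable-stable em (λ Z⊈A → none (Z , Z∈C , Z⊈A)) x x∈Z)
      ⋃⊈A
    ... | yes (Z , Z∈C , Z⊈A) with extreme-compare (y Z Z∈C) (extreme (y Z Z∈C)) t
    ...   | inj₁ A⊆Z = λ x → ⊆⋃ {C = C} Z∈C x ∘ extreme (y Z Z∈C) t A⊆Z Z⊈A x
    ...   | inj₂ growZ⊆A = contradiction (λ x → growZ⊆A x ∘ ⊆grow Z x) Z⊈A

    Tower-chain : ∀ {A B} → Tower A → Tower B → A ⊆ B ⊎ B ⊆ A
    Tower-chain {A} {B} s t with extreme-compare t (extreme t) s
    ... | inj₁ A⊆B = inj₁ A⊆B
    ... | inj₂ growB⊆A = inj₂ λ x → growB⊆A x ∘ ⊆grow B x

    P-Tower : ∀ {A} → Tower A → P A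
    P-Tower bottom = P-base
    P-Tower (step t) = P-grow (P-Tower t)
    P-Tower (union C base∈ t) = P-⋃ base∈ (λ A∈C → P-Tower (t _ A∈C))
      (λ A∈C B∈C → Tower-chain (t _ A∈C) (t _ B∈C))

    maximal : ∃ λ M → base ⊆ M × P M × (∀ {B} → P B → M ⊆ B → B ⊆ M)
    maximal = ⋃ ⟨ Tower ⟩ , base⊆ top , P-Tower top ,
      -- The union of the whole tower is in the tower, hence so is its `grow`, which is therefore
      -- contained in that union.
      grow⊆⇒maximal (⊆⋃ {C = ⟨ Tower ⟩} (∈⟨⟩⁺ (step top)))
      where
      top : Tower (⋃ ⟨ Tower ⟩)
      top = union ⟨ Tower ⟩ (∈⟨⟩⁺ bottom) (λ _ → ∈⟨⟩⁻)

  -- Comparability of cardinalities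

  -- Lets conditions that involve two elements at a time pass to unions of chains.
  common : {X : Set ℓ} {C : Subset (Subset X)} → Chain C → ∀ {x y} → x ∈ ⋃ C → y ∈ ⋃ C →
    ∃ λ A → A ∈ C × x ∈ A × y ∈ A
  common {C = C} chain {x} {y} x∈⋃ y∈⋃ =
    let A , A∈C , x∈A = ∈⋃⁻ C x∈⋃
        B , B∈C , y∈B = ∈⋃⁻ C y∈⋃
    in [ (λ A⊆B → B , B∈C , A⊆B x x∈A , y∈B) , (λ B⊆A → A , A∈C , x∈A , B⊆A y y∈B) ]′
         (chain A∈C B∈C)

  total-or-missed : {A B : Set ℓ} (R : Subset (A × B)) →
    (∀ x → ∃ λ y → (x , y) ∈ R) ⊎ (∃ λ x → ∀ y → ¬ (x , y) ∈ R)
  total-or-missed R with em {∃ λ x → ∀ y → ¬ (x , y) ∈ R}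
  ... | yes missed = inj₂ missed
  ... | no none = inj₁ λ x → decidable-stable em λ ¬∃ → none (x , λ y xRy → ¬∃ (y , xRy))

  module _ (A B : Set ℓ) where

    PartialInjection : Subset (A × B) → Set ℓ
    PartialInjection R = ∀ {x y x′ y′} → (x , y) ∈ R → (x′ , y′) ∈ R →
      (x ≡ x′ → y ≡ y′) × (y ≡ y′ → x ≡ x′)

    ⋃-PartialInjection : ∀ {C} → (∀ {R} → R ∈ C → PartialInjection R) → Chain C →
      PartialInjection (⋃ C)
    ⋃-PartialInjection inj chain xy∈ x′y′∈ =
      let R , R∈C , xRy , x′Ry′ = common chain xy∈ x′y′∈ in inj R∈C xRy x′Ry′

    add-PartialInjection : ∀ {R x₀ y₀} → PartialInjection R →
      (∀ y → ¬ (x₀ , y) ∈ R) → (∀ x → ¬ (x , y₀) ∈ R) →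
      PartialInjection ⟨ (λ p → p ∈ R ⊎ p ≡ (x₀ , y₀)) ⟩
    add-PartialInjection {R} {x₀} {y₀} inj x₀∉ y₀∉ p∈ q∈ = go (∈⟨⟩⁻ p∈) (∈⟨⟩⁻ q∈)
      where
      go : ∀ {x y x′ y′} → (x , y) ∈ R ⊎ (x , y) ≡ (x₀ , y₀) →
        (x′ , y′) ∈ R ⊎ (x′ , y′) ≡ (x₀ , y₀) → (x ≡ x′ → y ≡ y′) × (y ≡ y′ → x ≡ x′)
      go (inj₁ p)    (inj₁ q)    = inj p q
      go (inj₁ p)    (inj₂ refl) =
        (λ { refl → contradiction p (x₀∉ _) }) , (λ { refl → contradiction p (y₀∉ _) })
      go (inj₂ refl) (inj₁ q)    =
        (λ { refl → contradiction q (x₀∉ _) }) , (λ { refl → contradiction q (y₀∉ _) })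
      go (inj₂ refl) (inj₂ refl) = (λ _ → refl) , (λ _ → refl)

    -- If `M` misses some `x₀` on the left and some `y₀` on the right, adding `(x₀ , y₀)`
    -- contradicts maximality.
    maximal⇒↣-total : ∀ {M} → PartialInjection M →
      (∀ {R} → PartialInjection R → M ⊆ R → R ⊆ M) → A ↣ B ⊎ B ↣ A
    maximal⇒↣-total {M} inj M-max with total-or-missed M | total-or-missed (λ (y , x) → M (x , y))
    ... | inj₁ f | _      = inj₁ (mk↣ λ {x} {x′} → proj₂ (inj (proj₂ (f x)) (proj₂ (f x′))))
    ... | inj₂ _ | inj₁ g = inj₂ (mk↣ λ {y} {y′} → proj₁ (inj (proj₂ (g y)) (proj₂ (g y′))))
    ... | inj₂ (x₀ , x₀∉) | inj₂ (y₀ , y₀∉) = contradiction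
      (M-max (add-PartialInjection inj x₀∉ y₀∉) (λ _ → ∈⟨⟩⁺ ∘ inj₁) (x₀ , y₀) (∈⟨⟩⁺ (inj₂ refl)))
      (x₀∉ y₀)

    ↣-total : A ↣ B ⊎ B ↣ A
    ↣-total =
      let _ , _ , inj , M-max = Zorn.maximal PartialInjection (λ _ → false) (λ ())
                                  (λ _ inj chain → ⋃-PartialInjection inj chain)
      in maximal⇒↣-total inj M-max

  -- The square of an infinite set

  -- Zorn's lemma is applied to the graphs {(x , y , f (x , y))} of injections
  -- f : D × D → D with D ⊆ U, D being read off the diagonal.
  module _ {U : Set ℓ} where

    dom : Subset (U × U × U) → Subset U
    dom R = ⟨ (λ x → ∃ λ z → (x , x , z) ∈ R) ⟩

    dom⁻ : ∀ R {x} → x ∈ dom R → ∃ λ z → (x , x , z) ∈ R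
    dom⁻ R = ∈⟨⟩⁻

    dom-mono : ∀ {R S} → R ⊆ S → dom R ⊆ dom S
    dom-mono {R} R⊆S x x∈ = let z , p = dom⁻ R x∈ in ∈⟨⟩⁺ (z , R⊆S _ p)

    record Pairing (R : Subset (U × U × U)) : Set ℓ where
      field
        closed      : ∀ {x y z} → (x , y , z) ∈ R → x ∈ dom R × y ∈ dom R × z ∈ dom R
        total       : ∀ {x y} → x ∈ dom R → y ∈ dom R → ∃ λ z → (x , y , z) ∈ R
        functional  : ∀ {x y z z′} → (x , y , z) ∈ R → (x , y , z′) ∈ R → z ≡ z′
        unambiguous : ∀ {x y x′ y′ z} → (x , y , z) ∈ R → (x′ , y′ , z) ∈ R →
                      (x , y) ≡ (x′ , y′)

    open Pairing

    ⋃-Pairing : ∀ {C} → (∀ {R} → R ∈ C → Pairing R) → Chain C → Pairing (⋃ C)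
    ⋃-Pairing {C} pairing chain = record
      { closed = λ xyz∈ →
          let R , R∈C , xyz∈R = ∈⋃⁻ C xyz∈
              x∈ , y∈ , z∈ = closed (pairing R∈C) xyz∈R
              up = dom-mono (⊆⋃ {C = C} R∈C)
          in up _ x∈ , up _ y∈ , up _ z∈
      ; total = λ x∈ y∈ →
          -- Both diagonal triples lie in one member of the chain, whose domain then contains both
          -- points.
          let R , R∈C , p , q = common chain (proj₂ (dom⁻ (⋃ C) x∈)) (proj₂ (dom⁻ (⋃ C) y∈))
              z , r = total (pairing R∈C) (∈⟨⟩⁺ (_ , p)) (∈⟨⟩⁺ (_ , q))
          in z , ⊆⋃ {C = C} R∈C _ r
      ; functional = λ p∈ q∈ →
          let R , R∈C , p , q = common chain p∈ q∈ in functional (pairing R∈C) p q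
      ; unambiguous = λ p∈ q∈ →
          let R , R∈C , p , q = common chain p∈ q∈ in unambiguous (pairing R∈C) p q
      }

    -- Transports a pairing of `V` into `U`. It serves twice: for a copy of ℕ as the base of Zorn's
    -- lemma, and for a doubled domain as a proper extension.
    module Graph {V : Set ℓ} (φ : V ↣ U) (F : (V × V) ↣ V) where

      InGraph : U × U × U → Set ℓ
      InGraph t = Σ[ (v , w) ∈ V × V ] t ≡ (to φ v , to φ w , to φ (to F (v , w)))

      graph : Subset (U × U × U)
      graph = ⟨ InGraph ⟩

      graph⁻ : ∀ {t} → t ∈ graph → InGraph t
      graph⁻ = ∈⟨⟩⁻

      ∈graph : ∀ v w → (to φ v , to φ w , to φ (to F (v , w))) ∈ graph
      ∈graph v w = ∈⟨⟩⁺ ((v , w) , refl)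

      ∈dom : ∀ v → to φ v ∈ dom graph
      ∈dom v = ∈⟨⟩⁺ (_ , ∈graph v v)

      dom-graph⁻ : ∀ {x} → x ∈ dom graph → ∃ λ v → x ≡ to φ v
      dom-graph⁻ x∈ = let (v , _) , eq = graph⁻ (proj₂ (dom⁻ graph x∈)) in v , ,-injectiveˡ eq

      graph-Pairing : Pairing graph
      graph-Pairing = record
        { closed = λ t∈ → closed′ (graph⁻ t∈)
        ; total = λ x∈ y∈ → total′ (dom-graph⁻ x∈) (dom-graph⁻ y∈)
        ; functional = λ p∈ q∈ → functional′ (graph⁻ p∈) (graph⁻ q∈)
        ; unambiguous = λ p∈ q∈ → unambiguous′ (graph⁻ p∈) (graph⁻ q∈)
        }
        where
        closed′ : ∀ {x y z} → InGraph (x , y , z) → x ∈ dom graph × y ∈ dom graph × z ∈ dom graph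
        closed′ (_ , refl) = ∈dom _ , ∈dom _ , ∈dom _

        total′ : ∀ {x y} → (∃ λ v → x ≡ to φ v) → (∃ λ w → y ≡ to φ w) →
          ∃ λ z → (x , y , z) ∈ graph
        total′ (v , refl) (w , refl) = _ , ∈graph v w

        functional′ : ∀ {x y z z′} → InGraph (x , y , z) → InGraph (x , y , z′) → z ≡ z′
        functional′ (_ , refl) (_ , eq) = sym (trans (,-injectiveʳ (,-injectiveʳ eq))
          (cong (to φ ∘ to F) (cong₂ _,_ (injective φ (sym (,-injectiveˡ eq)))
            (injective φ (sym (,-injectiveˡ (,-injectiveʳ eq)))))))

        unambiguous′ : ∀ {x y x′ y′ z} → InGraph (x , y , z) → InGraph (x′ , y′ , z) →
          (x , y) ≡ (x′ , y′)
        unambiguous′ (_ , refl) (_ , eq) with injective F (injective φ (,-injectiveʳ (,-injectiveʳ eq)))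
        ... | refl = sym (cong₂ _,_ (,-injectiveˡ eq) (,-injectiveˡ (,-injectiveʳ eq)))

    pair : ∀ {R} → Pairing R → (Elem (dom R) × Elem (dom R)) ↣ Elem (dom R)
    pair {R} P = mk↣ {to = f} f-injective
      where
      f : Elem (dom R) × Elem (dom R) → Elem (dom R)
      f ((x , x∈) , (y , y∈)) =
        let z , p = total P x∈ y∈ in z , proj₂ (proj₂ (closed P p))

      f-injective : Injective _≡_ _≡_ f
      f-injective {(x , x∈) , (y , y∈)} {(x′ , x′∈) , (y′ , y′∈)} eq =
        cong₂ _,_ (Elem-≡ (,-injectiveˡ xy≡x′y′)) (Elem-≡ (,-injectiveʳ xy≡x′y′))
        where
        xy≡x′y′ : (x , y) ≡ (x′ , y′)
        xy≡x′y′ = unambiguous P (proj₂ (total P x∈ y∈))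
          (subst (λ z → (x′ , y′ , z) ∈ R) (sym (cong proj₁ eq)) (proj₂ (total P x′∈ y′∈)))

    -- Compare `D` with its complement. If `D` embeds there, the pairing extends to two copies of
    -- `D`, against maximality. Otherwise `U` embeds in `D ⊎ D`, hence in `D`, and inherits its
    -- pairing.
    maximal⇒square-↣ : ∀ {M} (P : Pairing M) → (∀ {R} → Pairing R → M ⊆ R → R ⊆ M) →
      {x y : Elem (dom M)} → x ≢ y → (U × U) ↣ U
    maximal⇒square-↣ {M} P M-max {x₀} x₀≢y₀ =
      [ (λ g → contradiction (M-max (graph-Pairing g) (M⊆graph g)) (graph⊈M g))
      , (λ b → let u = e ↣-∘ ((↣-id _ ⊎-↣ b) ↣-∘ split) in elem ↣-∘ (pair P ↣-∘ (u ×-↣ u)))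
      ]′ (↣-total D (Elem (∁ (dom M))))
      where
      open Partition (dom M)
      D = Elem (dom M)
      e = ⊎-square (pair P) x₀≢y₀
      open Doubling (pair P) e
      module _ (g : D ↣ Elem (∁ (dom M))) where
        open Graph (join g) doubling public

        M⊆graph : M ⊆ graph
        M⊆graph (x , y , z) xyz∈M =
          let x∈ , y∈ , _ = closed P xyz∈M
          in subst (λ z → (x , y , z) ∈ graph)
               (functional P (proj₂ (total P x∈ y∈)) xyz∈M)
               (∈graph (inj₁ (x , x∈)) (inj₁ (y , y∈)))

        -- The second copy of `x₀` is placed at `to g x₀`, which is in the new domain but outside
        -- `dom M`.
        graph⊈M : ¬ graph ⊆ M
        graph⊈M graph⊆M = ∈∁⇒∉ (dom M) (proj₂ (to g x₀))
          (dom-mono graph⊆M _ (∈dom (inj₂ x₀)))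

    square-↣ : ℕ ↣ U → (U × U) ↣ U
    square-↣ ι =
      -- Starting from a copy of ℕ puts the images of 0 and 1 into the maximal domain, as the two
      -- distinct points required.
      let M , base⊆M , P , M-max = Zorn.maximal Pairing graph graph-Pairing (λ _ → ⋃-Pairing)
          ι∈ : ℕ → Elem (dom M)
          ι∈ n = to φ (lift n) , dom-mono base⊆M _ (∈dom (lift n))
      in maximal⇒square-↣ P M-max {ι∈ 0} {ι∈ 1} λ eq →
           contradiction (cong lower (injective φ {lift 0} {lift 1} (cong proj₁ eq))) λ ()
      where
      φ : Lift ℓ ℕ ↣ U
      φ = mk↣ λ eq → cong lift (injective ι eq)

      F : (Lift ℓ ℕ × Lift ℓ ℕ) ↣ Lift ℓ ℕ
      F = mk↣ {to = λ (m , n) → lift (square+n (lower m , lower n))} λ eq →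
        let mn≡ = square+n-injective (cong lower eq)
        in cong₂ _,_ (cong lift (,-injectiveˡ mn≡)) (cong lift (,-injectiveʳ mn≡))

      open Graph φ F

  -- Schröder-Bernstein and the complement of a small subset

  module _ {U : Set ℓ} (S : Pred U ℓ) where

    module SchröderBernstein (h : U ↣ U) (h∈S : ∀ u → S (to h u)) where

      data Orbit : U → Set ℓ where
        start : ∀ {u} → ¬ S u → Orbit u
        next  : ∀ {u} → Orbit u → Orbit (to h u)

      -- Points outside `S` start orbits under `h`. Moving each orbit one step along `h` and fixing
      -- the rest vacates exactly the complement of `S`.
      shift : U → Σ[ u ∈ U ] S u
      shift u with em {Orbit u}
      ... | yes _ = to h u , h∈S u
      ... | no ¬o = u , decidable-stable em (¬o ∘ start)

      shift-orbit : ∀ {u} → Orbit u → proj₁ (shift u) ≡ to h u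
      shift-orbit {u} o with em {Orbit u}
      ... | yes _ = refl
      ... | no ¬o = contradiction o ¬o

      -- A moved point stays in an orbit, so it never meets a point left in place.
      shift-injective : ∀ {u v} → proj₁ (shift u) ≡ proj₁ (shift v) → u ≡ v
      shift-injective {u} {v} eq with em {Orbit u} | em {Orbit v}
      ... | yes _ | yes _ = injective h eq
      ... | yes o | no ¬o = contradiction (subst Orbit eq (next o)) ¬o
      ... | no ¬o | yes o = contradiction (subst Orbit (sym eq) (next o)) ¬o
      ... | no _  | no _  = eq

      shift-surjective : ∀ {s} → S s → ∃ λ u → proj₁ (shift u) ≡ s
      shift-surjective {s} s∈S with em {Orbit s}
      ... | yes (start s∉S)  = contradiction s∈S s∉S
      ... | yes (next {u} o) = u , shift-orbit o
      ... | no ¬o            = s , shift-fixed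
        where
        shift-fixed : proj₁ (shift s) ≡ s
        shift-fixed with em {Orbit s}
        ... | yes o = contradiction o ¬o
        ... | no _  = refl

      S≈U : ⟦ S ⟧ ≈ᶜ setoid U
      S≈U = Inverse⇒Bijection (Inverse.sym (Bijection⇒Inverse (record
        { to        = shift
        ; cong      = λ { refl → refl }
        ; bijective = shift-injective , λ (_ , s∈S) →
            let u , eq = shift-surjective s∈S in u , λ { refl → eq }
        })))

    -- If S met every column {x} × U of U × U ↣ U, choosing a point of S in each
    -- column would inject U into S.
    ∁-↣ : (U × U) ↣ U → ¬ (⟦ S ⟧ ≈ᶜ setoid U) → Σ[ e ∈ (U ↣ U) ] (∀ u → ¬ S (to e u))
    ∁-↣ p S≉U with em {∃ λ x → ∀ y → ¬ S (to p (x , y))}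
    ... | yes (x , x∉) = mk↣ (λ eq → ,-injectiveʳ (injective p eq)) , x∉
    ... | no none = contradiction (SchröderBernstein.S≈U h (proj₂ ∘ column)) S≉U
      where
      column : ∀ x → ∃ λ y → S (to p (x , y))
      column x = decidable-stable em λ ¬∃ → none (x , λ y s → ¬∃ (y , s))

      h : U ↣ U
      h = mk↣ {to = λ x → to p (x , proj₁ (column x))} λ eq → ,-injectiveˡ (injective p eq)

    -- The operation and its fixpoints

    module Star (code : (U × ℕ) ↣ U) (code∉S : ∀ q → ¬ S (to code q)) where

      rank : U → ℕ
      rank u with em {∃ λ q → to code q ≡ u}
      ... | yes ((_ , n) , _) = suc n
      ... | no _              = 0

      -- Injectivity of `code` makes the preimage found by `em` the given one.
      rank-code : ∀ w n → rank (to code (w , n)) ≡ suc n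
      rank-code w n with em {∃ λ q → to code q ≡ to code (w , n)}
      ... | yes (_ , eq) = cong (suc ∘ proj₂) (injective code eq)
      ... | no none      = contradiction (_ , refl) none

      module _ (p : (U × U) ↣ U) where

        ⋆ : U × U → U
        ⋆ (x , y) with em {x ≡ y × S x}
        ... | yes _ = x
        ... | no _  = to code (to p (x , y) , rank x ⊔ rank y)

        -- Values of the diagonal case lie in `S` and codes do not, so the cases never collide; a
        -- code still determines `p (x , y)`.
        ⋆-injective : Injective _≡_ _≡_ ⋆
        ⋆-injective {x , y} {x′ , y′} eq with em {x ≡ y × S x} | em {x′ ≡ y′ × S x′}
        ... | yes (refl , _) | yes (refl , _) = cong₂ _,_ eq eq
        ... | yes (_ , x∈S)  | no _           = contradiction (subst S eq x∈S) (code∉S _)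
        ... | no _           | yes (_ , x′∈S) = contradiction (subst S (sym eq) x′∈S) (code∉S _)
        ... | no _           | no _           = injective p (cong proj₁ (injective code eq))

        ⋆-idem : ∀ {s} → S s → ⋆ (s , s) ≡ s
        ⋆-idem {s} s∈S with em {s ≡ s × S s}
        ... | yes _ = refl
        ... | no ¬d = contradiction (refl , s∈S) ¬d

        map-fixed : ∀ {s} → S s → ∀ t → map t ⋆ s ≡ s
        map-fixed s∈S nil = refl
        map-fixed s∈S (bin t₁ t₂) =
          trans (cong₂ (λ x y → ⋆ (x , y)) (map-fixed s∈S t₁) (map-fixed s∈S t₂)) (⋆-idem s∈S)

        -- Mutual induction: the weak form covers a left subtree `nil`, and the root supplies the
        -- strict increase.
        rank-map-≤ : ∀ {u} → ¬ S u → ∀ t → rank u ≤ rank (map t ⋆ u)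
        rank-map-< : ∀ {u} → ¬ S u → ∀ t → t ≢ nil → rank u < rank (map t ⋆ u)

        rank-map-≤ u∉S nil           = ≤-refl
        rank-map-≤ u∉S t@(bin _ _)   = <⇒≤ (rank-map-< u∉S t λ ())

        rank-map-< u∉S nil t≢nil = contradiction refl t≢nil
        rank-map-< {u} u∉S (bin t₁ t₂) _ with em {map t₁ ⋆ u ≡ map t₂ ⋆ u × S (map t₁ ⋆ u)}
        -- The root returns the value of `t₁`, and `t₁` is not `nil` because that value is in `S`
        -- while `u` is not.
        ... | yes (_ , x∈S) = rank-map-< u∉S t₁ λ { refl → u∉S x∈S }
        ... | no _ = subst (rank u <_) (sym (rank-code _ _))
          (s≤s (≤-trans (rank-map-≤ u∉S t₁) (m≤m⊔n _ _)))

        fix≈S : ∀ t → t ≢ nil → ⟦ fix t ⋆ ⟧ ≈ᶜ ⟦ S ⟧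
        fix≈S t t≢nil = record
          { to        = λ (u , fixed) → u , decidable-stable em λ u∉S →
              <⇒≢ (rank-map-< u∉S t t≢nil) (cong rank (sym fixed))
          ; cong      = id
          ; bijective = id , λ (s , s∈S) → (s , map-fixed s∈S t) , id
          }

proposition11 : ∀ {ℓ} → ExcludedMiddle ℓ → Extensionality ℓ ℓ →
    (U : Set ℓ) → setoid ℕ ≤ᶜ setoid U →
    (S : Pred U ℓ) → ⟦ S ⟧ <ᶜ setoid U →
    Σ[ ⋆ ∈ (U × U → U) ]
    Injective _≡_ _≡_ ⋆ ×
    (∀ (t : BT) → t ≢ nil → ⟦ fix t ⋆ ⟧ ≈ᶜ ⟦ S ⟧)
proposition11 em ext U ι S (_ , S≉U) =
  ⋆ p , ⋆-injective p , fix≈S p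
  where
  open Classical em ext
  p = square-↣ ι
  e = ∁-↣ S p S≉U
  -- The code of `(w , n)` is `p (w , ι n)` sent through `e`, whose image avoids `S`.
  open Star S (proj₁ e ↣-∘ (p ↣-∘ (↣-id U ×-↣ ι))) (λ _ → proj₂ e _)
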